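{- For every $r\geq 3$ there exists a quasi-linear, head-tail-mixing $r$-graph $F$ which admits the descriptive sequence $X X\cdots X Z Z Y Y\cdots Y$ (consisting of $r-2$ letters $X$, followed by two letters $Z$, followed by $r-2$ letters $Y$).
   Context: An $r$-graph is an $r$-uniform hypergraph. A hypergraph $H$ is quasi-linear if for every edge $e$ there is a unique other edge $f$ (its twin) with $|e\cap f|=2$, and every edge $f'\notin\{e,f\}$ satisfies $|e\cap f'|\leq1$. A descriptive sequence of order $k$ is a sequence $\sigma=(s_1,\dots,s_{2k-2})$ over $\{X,Y,Z\}$ with exactly $k-2$ letters $X$, $k-2$ letters $Y$ and two letters $Z$. Given a linearly ordered vertex set and two $k$-edges $e,f$ with $|e\cap f|=2$, sort $e\cup f$ as $w_1\prec\dots\prec w_{2k-2}$; $\sigma$ describes $\{e,f\}$ if either ($s_i=X$ iff $w_i\in e\setminus f$, $s_i=Y$ iff $w_i\in f\setminus e$, $s_i=Z$ iff $w_i\in e\cap f$) or the same holds with $e,f$ swapped. A quasi-linear hypergraph admits $\sigma$ if there is a linear order of its vertex set in which every twin pair of edges is described by $\sigma$. Given a linear order on the vertices, the head of an edge is the set of its two smallest vertices and its tail is the set of its two largest vertices. A hypergraph is head-tail-mixing if for every linear order of its vertex set there exist edges $e,f$ such that the head of $e$ equals the tail of $f$. -}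

module Defs where

open import Data.Nat using (ℕ; _≤_; _∸_; _+_)
open import Data.Fin using (Fin) renaming (_<_ to _<ᶠ_)
open import Data.Fin.Subset using (Subset; _∈_; _∉_; _∩_; _∪_; ∣_∣)
open import Data.Fin.Permutation using (Permutation′; _⟨$⟩ʳ_)
open import Data.Vec using (Vec; replicate; _++_; _∷_; lookup)
open import Data.Product using (Σ; ∃; _×_; _,_)
open import Data.Sum using (_⊎_)
open import Function.Definitions using (Injective)
open import Relation.Binary.PropositionalEquality using (_≡_; _≢_)
open import Relation.Nullary using (¬_)

record UGraph (r : ℕ) : Set where
  field
    n        : ℕ
    m        : ℕ
    edge     : Fin m → Subset n
    uniform  : ∀ i → ∣ edge i ∣ ≡ r
    distinct : Injective _≡_ _≡_ edge

open UGraph public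

QuasiLinear : ∀ {r} → UGraph r → Set
QuasiLinear H =
  ∀ i → Σ (Fin (m H)) λ j → i ≢ j × ∣ edge H i ∩ edge H j ∣ ≡ 2
        × (∀ k → k ≢ i → k ≢ j → ∣ edge H i ∩ edge H k ∣ ≤ 1)

-- A linear order on Fin n is given by a permutation π: u precedes v iff π u < π v.
Order : ℕ → Set
Order n = Permutation′ n

_≺[_]_ : ∀ {n} → Fin n → Order n → Fin n → Set
u ≺[ π ] v = (π ⟨$⟩ʳ u) <ᶠ (π ⟨$⟩ʳ v)

data Letter : Set where
  X Y Z : Letter

Labels : ∀ {n L} → Vec Letter L → (Fin L → Fin n) → Subset n → Subset n → Set
Labels σ w e f =
  ∀ i → ((lookup σ i ≡ X → (w i ∈ e × w i ∉ f)) × ((w i ∈ e × w i ∉ f) → lookup σ i ≡ X))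
      × ((lookup σ i ≡ Y → (w i ∈ f × w i ∉ e)) × ((w i ∈ f × w i ∉ e) → lookup σ i ≡ Y))
      × ((lookup σ i ≡ Z → (w i ∈ e × w i ∈ f)) × ((w i ∈ e × w i ∈ f) → lookup σ i ≡ Z))

Describes : ∀ {n L} → Vec Letter L → Order n → Subset n → Subset n → Set
Describes {n} {L} σ π e f =
  Σ (Fin L → Fin n) λ w →
    (∀ i j → i <ᶠ j → w i ≺[ π ] w j)
    × (∀ v → (v ∈ (e ∪ f) → ∃ λ i → w i ≡ v) × (∀ i → w i ≡ v → v ∈ (e ∪ f)))
    × (Labels σ w e f ⊎ Labels σ w f e)

Admits : ∀ {r L} → UGraph r → Vec Letter L → Set
Admits H σ =
  Σ (Order (n H)) λ π →
    ∀ i j → i ≢ j → ∣ edge H i ∩ edge H j ∣ ≡ 2 → Describes σ π (edge H i) (edge H j)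

IsHead : ∀ {n} → Order n → Subset n → Subset n → Set
IsHead π e T = (∀ v → v ∈ T → v ∈ e) × ∣ T ∣ ≡ 2
             × (∀ u v → u ∈ T → v ∈ e → v ∉ T → u ≺[ π ] v)

IsTail : ∀ {n} → Order n → Subset n → Subset n → Set
IsTail π e T = (∀ v → v ∈ T → v ∈ e) × ∣ T ∣ ≡ 2
             × (∀ u v → u ∈ T → v ∈ e → v ∉ T → v ≺[ π ] u)

HeadTailMixing : ∀ {r} → UGraph r → Set
HeadTailMixing H =
  ∀ (π : Order (n H)) → Σ (Fin (m H)) λ i → Σ (Fin (m H)) λ j →
    Σ (Subset (n H)) λ T → IsHead π (edge H i) T × IsTail π (edge H j) T

seqXZZY : (r : ℕ) → Vec Letter ((r ∸ 2) + (2 + (r ∸ 2)))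
seqXZZY r = replicate (r ∸ 2) X ++ (Z ∷ Z ∷ replicate (r ∸ 2) Y)

{-# OPTIONS --safe #-}
module Submission where

open import Defs
open import Data.Empty using (⊥-elim)
open import Data.Fin using (Fin; zero; suc; toℕ; fromℕ<; combine; remQuot; opposite; finToFun; funToFin)
  renaming (_<_ to _<ᶠ_)
open import Data.Fin.Patterns using (0F; 1F)
open import Data.Fin.Permutation using (_⟨$⟩ʳ_) renaming (id to idₚ)
open import Data.Fin.Properties
  using (all?; toℕ<n; toℕ-fromℕ<; toℕ-injective; combine-injective; combine-injectiveˡ; combine-injectiveʳ;
         combine-surjective; combine-monoˡ-<; remQuot-combine; combine-remQuot; finToFun-funToFin)
  renaming (_≟_ to _≟ᶠ_; _<?_ to _<ᶠ?_; <-cmp to <ᶠ-cmp; suc-injective to sucᶠ-injective)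
open import Data.Fin.Subset using (Subset; inside; outside; ⊥; ⁅_⁆; _∈_; _∉_; _∩_; _∪_; ∣_∣)
open import Data.Fin.Subset.Properties
  using (∣⊥∣≡0; ∉⊥; x∈⁅x⁆; x∈⁅y⁆⇒x≡y; x∈p∪q⁺; x∈p∪q⁻; x∈p∩q⁺; x∈p∩q⁻;
         ∪-identityˡ; ∪-comm; ∩-comm; ∩-idem; ⊆-antisym)
open import Data.List using (List; []; _∷_; length; filter; lookup; allFin)
open import Data.List.Membership.Propositional using () renaming (_∈_ to _∈ˡ_)
open import Data.List.Membership.Propositional.Properties using (∈-filter⁺; ∈-lookup; ∈-allFin)
open import Data.List.Properties using (filter-all; length-tabulate)
open import Data.List.Relation.Binary.Sublist.Propositional using (_⊆_; []; _∷_; _∷ʳ_; ⊆-trans; minimum)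
open import Data.List.Relation.Binary.Sublist.Propositional.Properties
  using (All-resp-⊆; filter-⊆; filter⁺; length-mono-≤)
open import Data.List.Relation.Unary.All using (All; []; _∷_)
import Data.List.Relation.Unary.All as All
open import Data.List.Relation.Unary.All.Properties using (all-filter)
open import Data.List.Relation.Unary.AllPairs using (AllPairs; []; _∷_)
open import Data.List.Relation.Unary.AllPairs.Properties using (tabulate⁺-<)
open import Data.Nat using (ℕ; zero; suc; _+_; _*_; _^_; _∸_; _≤_; _<_; _≤?_; _<?_; z≤n; s≤s; NonZero)
open import Data.Nat.Properties
open import Data.Nat.Tactic.RingSolver using (solve-∀)
open import Data.Product using (Σ; ∃; _×_; _,_; proj₁; proj₂; uncurry; map₂)
open import Data.Sum using (_⊎_; inj₁; inj₂)
import Data.Sum as Sum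
open import Data.Vec using (Vec; []; _∷_; here; there; replicate; _++_) renaming (lookup to lookupᵛ)
open import Data.Vec.Properties using (lookup-replicate)
open import Function using (_∘_; id)
open import Function.Bundles using (module Injection)
open import Function.Definitions using (Injective)
open import Function.Properties.Inverse using (↔⇒↣)
open import Level using (Level; 0ℓ)
import Relation.Binary as Binary
open import Relation.Binary using (Rel; tri<; tri≈; tri>)
open import Relation.Binary.PropositionalEquality
  using (_≡_; _≢_; _≗_; refl; sym; trans; cong; cong₂; subst; subst₂; module ≡-Reasoning)
open import Relation.Nullary using (Dec; yes; no; ¬_; ¬?)
open import Relation.Nullary.Decidable using (_→-dec_; _⊎-dec_)
open import Relation.Unary using (Pred; Decidable)

-- Call A ∪ {u,v} ∪ B with |A| = |B| = r − 2 a gadget; it carries the twin edges A ∪ {u,v} and {u,v} ∪ B.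
-- If A < {u,v} < B in the base order, the gadget is described by X⋯XZZY⋯Y, and any order that is
-- monotone on it makes {u,v} the head of one edge and the tail of the other. So it suffices to have
-- gadgets, pairwise meeting in at most one vertex, such that every order is monotone on one of them.
-- Take q² "lines" y = α + iβ (α, β < q) over K columns, where K is a Ramsey number: two lines share
-- at most one point, and on each line every order is monotone on some 2r − 2 points. One gadget is
-- chosen per line, greedily: by pigeonhole some choice takes care of a fixed fraction 1/C of the
-- orders still to be handled. There are only N^N orders with N = O(q) points, so for large q
-- the q² choices exhaust them, as N^N (1 − 1/C)^(q²) < 1.

private variable
  a p ℓ : Level
  A : Set a

-- Ramsey's theorem for two colours and monotone subsequences.

length-filter-∁ : {P : Pred A p} (P? : Decidable P) (xs : List A) →
  length (filter P? xs) + length (filter (¬? ∘ P?) xs) ≡ length xs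
length-filter-∁ P? []       = refl
length-filter-∁ P? (x ∷ xs) with P? x
... | yes _ = cong suc (length-filter-∁ P? xs)
... | no  _ = trans (+-suc _ _) (cong suc (length-filter-∁ P? xs))

AllPairs-resp-⊆ : {R : Rel A ℓ} {xs ys : List A} → xs ⊆ ys → AllPairs R ys → AllPairs R xs
AllPairs-resp-⊆ []          []         = []
AllPairs-resp-⊆ (_ ∷ʳ τ)    (_ ∷ rys)  = AllPairs-resp-⊆ τ rys
AllPairs-resp-⊆ (refl ∷ τ)  (ry ∷ rys) = All-resp-⊆ τ ry ∷ AllPairs-resp-⊆ τ rys

AllPairs-lookup : {R : Rel A ℓ} {xs : List A} → AllPairs R xs →
  ∀ i j → i <ᶠ j → R (lookup xs i) (lookup xs j)
AllPairs-lookup (rx ∷ _)  zero    (suc j) _         = All.lookup rx (∈-lookup j)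
AllPairs-lookup (_ ∷ rxs) (suc i) (suc j) (s≤s i<j) = AllPairs-lookup rxs i j i<j

-- An upper bound of Erdős-Szekeres type, not the exact Ramsey number: one element is set aside, and
-- the two summands serve the two colours it can have towards the others.
ramseyNumber : ℕ → ℕ → ℕ
ramseyNumber zero    _       = 0
ramseyNumber (suc _) zero    = 0
ramseyNumber (suc a) (suc b) = suc (ramseyNumber a (suc b) + ramseyNumber (suc a) b)

+-≤-split : ∀ {m n x y} → m + n ≤ x + y → m ≤ x ⊎ n ≤ y
+-≤-split {m} {n} {x} {y} m+n≤x+y with m ≤? x
... | yes m≤x = inj₁ m≤x
... | no  m≰x = inj₂ (+-cancelˡ-≤ m n y (≤-trans m+n≤x+y (+-monoˡ-≤ y (<⇒≤ (≰⇒> m≰x)))))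

-- The tail splits into the elements that the head `x` is related to and the rest, and one of the
-- two is long enough for induction. A sequence of the matching colour is extended by `x`; one of
-- the other colour is already long enough. Since `x` comes first in the list, `R` may be
-- asymmetric.
ramsey : {R : Rel A ℓ} → Binary.Decidable R → ∀ a b (xs : List A) → ramseyNumber a b ≤ length xs →
  ∃ λ ys → ys ⊆ xs × (length ys ≡ a × AllPairs R ys ⊎ length ys ≡ b × AllPairs (λ x y → ¬ R x y) ys)
ramsey R? zero    b       xs       _         = [] , minimum xs , inj₁ (refl , [])
ramsey R? (suc a) zero    xs       _         = [] , minimum xs , inj₂ (refl , [])
ramsey R? (suc a) (suc b) (x ∷ xs) (s≤s len)
  with +-≤-split (≤-trans len (≤-reflexive (sym (length-filter-∁ (R? x) xs))))
... | inj₁ len₁ with ramsey R? a (suc b) (filter (R? x) xs) len₁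
...   | ys , τ , inj₁ (refl , rys) = x ∷ ys , refl ∷ ⊆-trans τ (filter-⊆ (R? x) xs) ,
                                     inj₁ (refl , All-resp-⊆ τ (all-filter (R? x) xs) ∷ rys)
...   | ys , τ , inj₂ blue         = ys , x ∷ʳ ⊆-trans τ (filter-⊆ (R? x) xs) , inj₂ blue
ramsey R? (suc a) (suc b) (x ∷ xs) (s≤s len)
    | inj₂ len₂ with ramsey R? (suc a) b (filter (¬? ∘ R? x) xs) len₂
...   | ys , τ , inj₁ red          = ys , x ∷ʳ ⊆-trans τ (filter-⊆ (¬? ∘ R? x) xs) , inj₁ red
...   | ys , τ , inj₂ (refl , rys) = x ∷ ys , refl ∷ ⊆-trans τ (filter-⊆ (¬? ∘ R? x) xs) ,
                                     inj₂ (refl , All-resp-⊆ τ (all-filter (¬? ∘ R? x) xs) ∷ rys)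

Increasing : ∀ {k n} → (Fin k → Fin n) → Set
Increasing w = ∀ s t → s <ᶠ t → w s <ᶠ w t

increasing? : ∀ {k n} (w : Fin k → Fin n) → Dec (Increasing w)
increasing? w = all? λ s → all? λ t → (s <ᶠ? t) →-dec (w s <ᶠ? w t)

-- Weak inequalities let arbitrary maps be treated like orders; for a permutation they become strict
-- by injectivity.
Monotone : ∀ {k} → (Fin k → ℕ) → Set
Monotone x = (∀ s t → s <ᶠ t → x s ≤ x t) ⊎ (∀ s t → s <ᶠ t → x t ≤ x s)

monotone? : ∀ {k} (x : Fin k → ℕ) → Dec (Monotone x)
monotone? x = (all? λ s → all? λ t → (s <ᶠ? t) →-dec (x s ≤? x t))
        ⊎-dec (all? λ s → all? λ t → (s <ᶠ? t) →-dec (x t ≤? x s))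

Monotone-cong : ∀ {k} {x y : Fin k → ℕ} → x ≗ y → Monotone x → Monotone y
Monotone-cong eq = Sum.map (λ mon s t s<t → subst₂ _≤_ (eq s) (eq t) (mon s t s<t))
                           (λ mon s t s<t → subst₂ _≤_ (eq t) (eq s) (mon s t s<t))

-- The map `w` is fixed before `R`, so that one enumeration transports both the order of the
-- positions and the colour of the pairs.
enumerate : ∀ {A : Set} {k} (xs : List A) → length xs ≡ k →
  ∃ λ (w : Fin k → A) → {R : Rel A 0ℓ} → AllPairs R xs → ∀ i j → i <ᶠ j → R (w i) (w j)
enumerate xs refl = lookup xs , AllPairs-lookup

-- Pairs of positions are coloured by whether `x i ≤ x j`. The list of all positions is sorted,
-- hence so is the homogeneous sublist that `ramsey` extracts.
monotone-subsequence : ∀ k (x : Fin (ramseyNumber k k) → ℕ) →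
  ∃ λ (w : Fin k → Fin (ramseyNumber k k)) → Increasing w × Monotone (x ∘ w)
monotone-subsequence k x
  with ramsey (λ i j → x i ≤? x j) k k (allFin _) (≤-reflexive (sym (length-tabulate id)))
... | ys , τ , colour with enumerate ys (Sum.[ proj₁ , proj₁ ]′ colour)
...   | w , pairs = w , pairs (AllPairs-resp-⊆ τ (tabulate⁺-< id)) ,
  Sum.map (pairs ∘ proj₂) (λ down s t s<t → <⇒≤ (≰⇒> (pairs (proj₂ down) s t s<t))) colour

-- Greedy covering by pigeonhole.

-- Induction on the number of choices: if choice `zero` falls short of the average, it is discarded
-- with the elements it serves, and a popular choice for the remaining elements makes up for them.
popular : ∀ c {Good : Fin (suc c) → Pred A p} (good? : ∀ b → Decidable (Good b)) (xs : List A) →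
  All (λ x → ∃ λ b → Good b x) xs → ∃ λ b → length xs ≤ suc c * length (filter (good? b) xs)
popular zero {Good} good? xs hit = zero , ≤-reflexive (sym (trans (*-identityˡ _) (cong length everything)))
  where
  everything : filter (good? zero) xs ≡ xs
  everything = filter-all (good? zero) (All.map (λ { (zero , g) → g }) hit)
popular (suc c) {Good} good? xs hit with length xs ≤? suc (suc c) * length (filter (good? zero) xs)
... | yes len≤ = zero , len≤
... | no  len≰ = suc b , bound
  where
  rest : List _
  rest = filter (¬? ∘ good? zero) xs
  shift : ∀ {x} → ∃ (λ b → Good b x) × ¬ Good zero x → ∃ λ b → Good (suc b) x
  shift ((zero  , g) , ¬g) = ⊥-elim (¬g g)
  shift ((suc b , g) , _)  = b , g
  hit′ : All (λ x → ∃ λ b → Good (suc b) x) rest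
  hit′ = All.map shift (All.zip (All-resp-⊆ (filter-⊆ (¬? ∘ good? zero) xs) hit , all-filter (¬? ∘ good? zero) xs))
  ih : ∃ λ b → length rest ≤ suc c * length (filter (good? (suc b)) rest)
  ih = popular c (good? ∘ suc) rest hit′
  b = proj₁ ih
  g₀ g₁ : ℕ
  g₀ = length (filter (good? zero) xs)
  g₁ = length (filter (good? (suc b)) xs)
  rest≤ : length rest ≤ suc c * g₁
  rest≤ = ≤-trans (proj₂ ih) (*-monoʳ-≤ (suc c)
    (length-mono-≤ (filter⁺ (good? (suc b)) (good? (suc b)) (λ { refl → id }) (filter-⊆ (¬? ∘ good? zero) xs))))
  split : g₀ + length rest ≡ length xs
  split = length-filter-∁ (good? zero) xs
  -- Cancelling `g₀` from `(c + 2) * g₀ < length xs` leaves `(c + 1) * g₀ < length rest ≤ (c + 1) *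
  -- g₁`.
  g₀<g₁ : g₀ < g₁
  g₀<g₁ = *-cancelˡ-< (suc c) g₀ g₁ (<-≤-trans
    (+-cancelˡ-< g₀ _ _ (subst (suc (suc c) * g₀ <_) (sym split) (≰⇒> len≰))) rest≤)
  bound : length xs ≤ suc (suc c) * g₁
  bound = subst (_≤ suc (suc c) * g₁) split (+-mono-≤ (<⇒≤ g₀<g₁) rest≤)

-- Taking a popular choice at each step leaves at most the fraction `c / (c + 1)` of the list
-- uncovered. The bound on `length xs` is preserved by this, and with no steps remaining it says
-- that the list is empty.
greedy : ∀ m c {Good : Fin m → Fin (suc c) → Pred A p} (good? : ∀ l b → Decidable (Good l b)) →
  (∀ l x → ∃ λ b → Good l b x) → ∀ xs → length xs * c ^ m < suc c ^ m →
  ∃ λ (f : Fin m → Fin (suc c)) → ∀ {x} → x ∈ˡ xs → ∃ λ l → Good l (f l) x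
greedy zero c good? hit []       _          = (λ ()) , λ ()
greedy zero c good? hit (_ ∷ _)  (s≤s ())
greedy {A = A} (suc m) c {Good} good? hit xs few = f , covered
  where
  first : ∃ λ b → length xs ≤ suc c * length (filter (good? zero b) xs)
  first = popular c (good? zero) xs (All.universal (hit zero) xs)
  b₀ = proj₁ first
  rest : List A
  rest = filter (¬? ∘ good? zero b₀) xs
  g₀ : ℕ
  g₀ = length (filter (good? zero b₀) xs)
  split : g₀ + length rest ≡ length xs
  split = length-filter-∁ (good? zero b₀) xs
  shrink : suc c * length rest ≤ c * length xs
  shrink = +-cancelˡ-≤ (length xs) _ _ (begin
    length xs + suc c * length rest  ≤⟨ +-monoˡ-≤ _ (proj₂ first) ⟩
    suc c * g₀ + suc c * length rest ≡⟨ sym (*-distribˡ-+ (suc c) g₀ _) ⟩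
    suc c * (g₀ + length rest)       ≡⟨ cong (suc c *_) split ⟩
    suc c * length xs                ∎)
    where open ≤-Reasoning
  few′ : length rest * c ^ m < suc c ^ m
  few′ = *-cancelˡ-< (suc c) _ _ (begin-strict
    suc c * (length rest * c ^ m) ≡⟨ sym (*-assoc (suc c) (length rest) _) ⟩
    suc c * length rest * c ^ m   ≤⟨ *-monoˡ-≤ (c ^ m) shrink ⟩
    c * length xs * c ^ m         ≡⟨ cong (_* c ^ m) (*-comm c (length xs)) ⟩
    length xs * c * c ^ m         ≡⟨ *-assoc (length xs) c _ ⟩
    length xs * c ^ suc m         <⟨ few ⟩
    suc c ^ suc m                 ∎)
    where open ≤-Reasoning
  ih : ∃ λ (f : Fin m → Fin (suc c)) → ∀ {x} → x ∈ˡ rest → ∃ λ l → Good (suc l) (f l) x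
  ih = greedy m c (good? ∘ suc) (hit ∘ suc) rest few′
  f : Fin (suc m) → Fin (suc c)
  f zero    = b₀
  f (suc l) = proj₁ ih l
  covered : ∀ {x} → x ∈ˡ xs → ∃ λ l → Good l (f l) x
  covered {x} x∈xs with good? zero b₀ x
  ... | yes g = zero , g
  ... | no ¬g with proj₂ ih (∈-filter⁺ (¬? ∘ good? zero b₀) x∈xs ¬g)
  ...   | l , g = suc l , g

-- Exponential estimates: the number of lines outgrows the number of orders.

n<2^n : ∀ n → n < 2 ^ n
n<2^n zero    = s≤s z≤n
n<2^n (suc n) = +-mono-≤-< (m^n>0 2 n) (≤-trans (n<2^n n) (m≤m+n _ 0))

-- Bernoulli's inequality `(1 + 1/c)^j ≥ 1 + j/c` with denominators cleared. The added term
-- `j * c ^ j` completes the product `(c + 1) * (c + j)`.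
bernoulli : ∀ c j → (c + j) * c ^ j ≤ c * suc c ^ j
bernoulli c zero    = ≤-reflexive (cong (_* 1) (+-identityʳ c))
bernoulli c (suc j) = begin
  (c + suc j) * (c * c ^ j)   ≤⟨ m≤m+n _ (j * c ^ j) ⟩
  (c + suc j) * (c * c ^ j) + j * c ^ j ≡⟨ expand c j (c ^ j) ⟩
  suc c * ((c + j) * c ^ j)   ≤⟨ *-monoʳ-≤ (suc c) (bernoulli c j) ⟩
  suc c * (c * suc c ^ j)     ≡⟨ swap (suc c) c (suc c ^ j) ⟩
  c * (suc c * suc c ^ j)     ∎
  where
  open ≤-Reasoning
  expand : ∀ c j x → (c + suc j) * (c * x) + j * x ≡ suc c * ((c + j) * x)
  expand = solve-∀
  swap : ∀ x y z → x * (y * z) ≡ y * (x * z)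
  swap = solve-∀

-- Bernoulli at `j = c`: every `c` greedy steps at least halve what is uncovered.
2*c^c≤[1+c]^c : ∀ c .{{_ : NonZero c}} → 2 * c ^ c ≤ suc c ^ c
2*c^c≤[1+c]^c c = *-cancelˡ-≤ c (≤-trans (≤-reflexive (double c (c ^ c))) (bernoulli c c))
  where
  double : ∀ c x → c * (2 * x) ≡ (c + c) * x
  double = solve-∀

*-^-distrib : ∀ m n o → (m * n) ^ o ≡ m ^ o * n ^ o
*-^-distrib m n zero    = refl
*-^-distrib m n (suc o) = trans (cong (m * n *_) (*-^-distrib m n o)) (interchange m n (m ^ o) (n ^ o))
  where
  interchange : ∀ a b c d → a * b * (c * d) ≡ a * c * (b * d)
  interchange = solve-∀

2^L*c^cL≤[1+c]^cL : ∀ c L .{{_ : NonZero c}} → 2 ^ L * c ^ (c * L) ≤ suc c ^ (c * L)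
2^L*c^cL≤[1+c]^cL c L = begin
  2 ^ L * c ^ (c * L)   ≡⟨ cong (2 ^ L *_) (sym (^-*-assoc c c L)) ⟩
  2 ^ L * (c ^ c) ^ L   ≡⟨ sym (*-^-distrib 2 (c ^ c) L) ⟩
  (2 * c ^ c) ^ L       ≤⟨ ^-monoˡ-≤ L (2*c^c≤[1+c]^c c) ⟩
  (suc c ^ c) ^ L       ≡⟨ ^-*-assoc (suc c) c L ⟩
  suc c ^ (c * L)       ∎
  where
  open ≤-Reasoning

linear-beaten : ∀ α D → ∃ λ u → (α + u) * D < 2 ^ u
-- The exponent has two parts: `2 ^ suc β` dominates `α + u`, and `2 ^ D` exceeds `D`.
linear-beaten α D = suc β + D , (begin-strict
  (α + (suc β + D)) * D ≤⟨ *-monoˡ-≤ D α+u≤ ⟩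
  2 ^ suc β * D         <⟨ *-monoʳ-< (2 ^ suc β) {{m^n≢0 2 (suc β)}} (n<2^n D) ⟩
  2 ^ suc β * 2 ^ D     ≡⟨ sym (^-distribˡ-+-* 2 (suc β) D) ⟩
  2 ^ (suc β + D)       ∎)
  where
  open ≤-Reasoning
  β : ℕ
  β = α + D
  rearrange : ∀ x y → x + (suc (x + y) + y) ≡ x + y + suc (x + y)
  rearrange = solve-∀
  α+u≤ : α + (suc β + D) ≤ 2 ^ suc β
  α+u≤ = begin
    α + (suc β + D)      ≡⟨ rearrange α D ⟩
    β + suc β            ≤⟨ +-mono-≤ (<⇒≤ (n<2^n β)) (n<2^n β) ⟩
    2 ^ β + 2 ^ β        ≡⟨ cong (2 ^ β +_) (sym (+-identityʳ (2 ^ β))) ⟩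
    2 ^ suc β            ∎

-- For fixed `c` and `D`, the number of self-maps of `D * q` points is only `2 ^ O(q log q)`, while
-- `q * q` greedy steps gain a factor of at least `2 ^ (q * q / c)` when `c` divides `q * q`.
few-orders : ∀ c D .{{_ : NonZero c}} →
  ∃ λ q → (D * q) ^ (D * q) * c ^ (q * q) < suc c ^ (q * q)
few-orders zero D {{()}}
-- Without points `0 ^ 0` is 1, and `q = 1` leaves `c < suc c`.
few-orders c@(suc _) zero    = 1 , subst₂ _<_ (sym (trans (*-identityˡ _) (*-identityʳ c))) (sym (*-identityʳ (suc c))) ≤-refl
few-orders c@(suc _) D@(suc _) with linear-beaten (D * c) D
... | u , small = q , (begin-strict
  (D * q) ^ (D * q) * c ^ (q * q) <⟨ *-monoˡ-< (c ^ (q * q)) {{m^n≢0 c (q * q)}} orders< ⟩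
  2 ^ L * c ^ (q * q)             ≡⟨ cong (λ m → 2 ^ L * c ^ m) q²≡ ⟩
  2 ^ L * c ^ (c * L)             ≤⟨ 2^L*c^cL≤[1+c]^cL c L ⟩
  suc c ^ (c * L)                 ≡⟨ cong (suc c ^_) (sym q²≡) ⟩
  suc c ^ (q * q)                 ∎)
  where
  open ≤-Reasoning
  q L : ℕ
  -- The factor `c` makes `q * q` a multiple of `c`; the factor `2 ^ u` bounds the binary logarithm
  -- of `D * q` by `D * c + u`, which `u` was chosen to control.
  q = c * 2 ^ u
  L = q * 2 ^ u
  q²≡ : q * q ≡ c * L
  q²≡ = assoc c (2 ^ u) q
    where
    assoc : ∀ c x q → q * (c * x) ≡ c * (q * x)
    assoc = solve-∀
  Dq≤ : D * q ≤ 2 ^ (D * c + u)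
  Dq≤ = begin
    D * q                   ≡⟨ sym (*-assoc D c (2 ^ u)) ⟩
    D * c * 2 ^ u           ≤⟨ *-monoˡ-≤ (2 ^ u) (<⇒≤ (n<2^n (D * c))) ⟩
    2 ^ (D * c) * 2 ^ u     ≡⟨ sym (^-distribˡ-+-* 2 (D * c) u) ⟩
    2 ^ (D * c + u)         ∎
  orders< : (D * q) ^ (D * q) < 2 ^ L
  orders< = begin-strict
    (D * q) ^ (D * q)               ≤⟨ ^-monoˡ-≤ (D * q) Dq≤ ⟩
    (2 ^ (D * c + u)) ^ (D * q)     ≡⟨ ^-*-assoc 2 (D * c + u) (D * q) ⟩
    2 ^ ((D * c + u) * (D * q))     <⟨ ^-monoʳ-< 2 (s≤s (s≤s z≤n)) exponent< ⟩
    2 ^ L                           ∎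
    where
    rotate : ∀ x D q → x * (D * q) ≡ q * (x * D)
    rotate = solve-∀
    exponent< : (D * c + u) * (D * q) < L
    exponent< = subst (_< L) (sym (rotate (D * c + u) D q)) (*-monoʳ-< q {{m*n≢0 c (2 ^ u) {{_}} {{m^n≢0 2 u}}}} small)

-- Cardinalities of subsets, images and segments of sequences.

∣⁅x⁆∪p∣ : ∀ {n} (x : Fin n) (p : Subset n) → x ∉ p → ∣ ⁅ x ⁆ ∪ p ∣ ≡ suc ∣ p ∣
∣⁅x⁆∪p∣ zero    (inside  ∷ p) x∉p = ⊥-elim (x∉p here)
∣⁅x⁆∪p∣ zero    (outside ∷ p) _   = cong (suc ∘ ∣_∣) (∪-identityˡ p)
∣⁅x⁆∪p∣ (suc x) (inside  ∷ p) x∉p = cong suc (∣⁅x⁆∪p∣ x p (x∉p ∘ there))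
∣⁅x⁆∪p∣ (suc x) (outside ∷ p) x∉p = ∣⁅x⁆∪p∣ x p (x∉p ∘ there)

subsingleton⇒∣p∣≤1 : ∀ {n} (p : Subset n) → (∀ {x y} → x ∈ p → y ∈ p → x ≡ y) → ∣ p ∣ ≤ 1
subsingleton⇒∣p∣≤1 []            _    = z≤n
subsingleton⇒∣p∣≤1 (outside ∷ p) uniq = subsingleton⇒∣p∣≤1 p λ x∈p y∈p → sucᶠ-injective (uniq (there x∈p) (there y∈p))
subsingleton⇒∣p∣≤1 {suc n} (inside ∷ p) uniq = s≤s (≤-reflexive (trans (cong ∣_∣ p≡⊥) (∣⊥∣≡0 n)))
  where
  p≡⊥ : p ≡ ⊥
  p≡⊥ = ⊆-antisym (λ x∈p → ⊥-elim (0≢suc (uniq here (there x∈p)))) (⊥-elim ∘ ∉⊥)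
    where
    0≢suc : ∀ {x : Fin n} → zero ≢ suc x
    0≢suc ()

image : ∀ {a n} → (Fin a → Fin n) → Subset n
image {zero}  g = ⊥
image {suc a} g = ⁅ g zero ⁆ ∪ image (g ∘ suc)

∈-image⁺ : ∀ {a n} (g : Fin a → Fin n) t → g t ∈ image g
∈-image⁺ g zero    = x∈p∪q⁺ (inj₁ (x∈⁅x⁆ (g zero)))
∈-image⁺ g (suc t) = x∈p∪q⁺ (inj₂ (∈-image⁺ (g ∘ suc) t))

∈-image⁻ : ∀ {a n} (g : Fin a → Fin n) {v} → v ∈ image g → ∃ λ t → g t ≡ v
∈-image⁻ {zero}  g v∈ = ⊥-elim (∉⊥ v∈)
∈-image⁻ {suc a} g v∈ with x∈p∪q⁻ ⁅ g zero ⁆ (image (g ∘ suc)) v∈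
... | inj₁ v∈⁅⁆ = zero , sym (x∈⁅y⁆⇒x≡y (g zero) v∈⁅⁆)
... | inj₂ v∈im with ∈-image⁻ (g ∘ suc) v∈im
...   | t , eq = suc t , eq

∣image∣ : ∀ {a n} (g : Fin a → Fin n) → Injective _≡_ _≡_ g → ∣ image g ∣ ≡ a
∣image∣ {zero} {n} g inj = ∣⊥∣≡0 n
∣image∣ {suc a}    g inj = trans (∣⁅x⁆∪p∣ (g zero) (image (g ∘ suc)) fresh)
                                 (cong suc (∣image∣ (g ∘ suc) (sucᶠ-injective ∘ inj)))
  where
  fresh : g zero ∉ image (g ∘ suc)
  fresh g0∈ with ∈-image⁻ (g ∘ suc) g0∈
  ... | t , eq with inj eq
  ...   | ()

Increasing⇒Injective : ∀ {k n} {w : Fin k → Fin n} → Increasing w → Injective _≡_ _≡_ w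
Increasing⇒Injective {w = w} inc {s} {t} eq with <ᶠ-cmp s t
... | tri< s<t _ _   = ⊥-elim (<-irrefl (cong toℕ eq) (inc s t s<t))
... | tri≈ _ s≡t _   = s≡t
... | tri> _ _ t<s   = ⊥-elim (<-irrefl (cong toℕ (sym eq)) (inc t s t<s))

block : ∀ {k} o l → o + l ≤ k → Fin l → Fin k
block o l o+l≤k t = fromℕ< (<-≤-trans (+-monoʳ-< o (toℕ<n t)) o+l≤k)

toℕ-block : ∀ {k} o l (o+l≤k : o + l ≤ k) t → toℕ (block o l o+l≤k t) ≡ o + toℕ t
toℕ-block o l o+l≤k t = toℕ-fromℕ< (<-≤-trans (+-monoʳ-< o (toℕ<n t)) o+l≤k)

-- Twin edges and their intersection are all runs of consecutive gadget points, so membership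
-- becomes a pair of inequalities between positions.
segment : ∀ {k n} → (Fin k → Fin n) → ∀ o l → o + l ≤ k → Subset n
segment w o l o+l≤k = image (w ∘ block o l o+l≤k)

module _ {k n} (w : Fin k → Fin n) o l (o+l≤k : o + l ≤ k) where

  ∈-segment⁺ : ∀ t → o ≤ toℕ t → toℕ t < o + l → w t ∈ segment w o l o+l≤k
  ∈-segment⁺ t o≤t t<o+l = subst (λ u → w u ∈ segment w o l o+l≤k) (toℕ-injective eq) (∈-image⁺ _ s)
    where
    t∸o<l : toℕ t ∸ o < l
    t∸o<l = +-cancelˡ-< o _ _ (subst (_< o + l) (sym (m+[n∸m]≡n o≤t)) t<o+l)
    s : Fin l
    s = fromℕ< t∸o<l
    eq : toℕ (block o l o+l≤k s) ≡ toℕ t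
    eq = trans (toℕ-block o l o+l≤k s) (trans (cong (o +_) (toℕ-fromℕ< t∸o<l)) (m+[n∸m]≡n o≤t))

  ∈-segment⁻ : ∀ {v} → v ∈ segment w o l o+l≤k → ∃ λ t → w t ≡ v × o ≤ toℕ t × toℕ t < o + l
  ∈-segment⁻ v∈ with ∈-image⁻ _ v∈
  ... | s , eq = block o l o+l≤k s , eq , subst (o ≤_) (sym (toℕ-block o l o+l≤k s)) (m≤m+n o _) ,
                 subst (_< o + l) (sym (toℕ-block o l o+l≤k s)) (+-monoʳ-< o (toℕ<n s))

  ∣segment∣ : Injective _≡_ _≡_ w → ∣ segment w o l o+l≤k ∣ ≡ l
  ∣segment∣ inj = ∣image∣ _ λ {s} {t} eq → toℕ-injective (+-cancelˡ-≡ o _ _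
    (trans (sym (toℕ-block o l o+l≤k s)) (trans (cong toℕ (inj eq)) (toℕ-block o l o+l≤k t))))

-- The letters of the descriptive sequence.

Describes-sym : ∀ {n L} {σ : Vec Letter L} {π : Order n} {e f} → Describes σ π e f → Describes σ π f e
Describes-sym {σ = σ} {π} {e} {f} (w , increasing , covers , labels) =
  w , increasing ,
  subst (λ p → ∀ v → (v ∈ p → ∃ λ i → w i ≡ v) × (∀ i → w i ≡ v → v ∈ p)) (∪-comm e f) covers ,
  Sum.swap labels

-- Indexed by the letter, so that a case split on the location of `i` also determines the letter
-- found there.
data Position (a : ℕ) (i : ℕ) : Letter → Set where
  before : i < a → Position a i X
  middle : a ≤ i → i < 2 + a → Position a i Z
  after  : 2 + a ≤ i → Position a i Y

letter-position : ∀ a b (i : Fin (a + (2 + b))) →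
  Position a (toℕ i) (lookupᵛ (replicate a X ++ Z ∷ Z ∷ replicate b Y) i)
letter-position zero    b zero          = middle z≤n (s≤s z≤n)
letter-position zero    b (suc zero)    = middle z≤n (s≤s (s≤s z≤n))
letter-position zero    b (suc (suc i)) rewrite lookup-replicate i Y = after (s≤s (s≤s z≤n))
letter-position (suc a) b zero          = before (s≤s z≤n)
letter-position (suc a) b (suc i)       with lookupᵛ (replicate a X ++ Z ∷ Z ∷ replicate b Y) i | letter-position a b i
... | _ | before i<a       = before (s≤s i<a)
... | _ | middle a≤i i<2+a = middle (s≤s a≤i) (s≤s i<2+a)
... | _ | after 2+a≤i      = after (s≤s 2+a≤i)

-- The hypergraph of twin edges carried by a linear family of gadgets.

module Gadgets
  (a : ℕ) (1≤a : 1 ≤ a) {m N : ℕ}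
  (w : Fin m → Fin (a + (2 + a)) → Fin N)
  (w-inc : ∀ ℓ → Increasing (w ℓ))
  (w-linear : ∀ {ℓ ℓ′} → ℓ ≢ ℓ′ → ∀ {s t s′ t′} → w ℓ s ≡ w ℓ′ s′ → w ℓ t ≡ w ℓ′ t′ → w ℓ s ≡ w ℓ t)
  where

  w-inj : ∀ ℓ → Injective _≡_ _≡_ (w ℓ)
  w-inj ℓ = Increasing⇒Injective (w-inc ℓ)

  -- In the notation of the overview, `L ℓ` is A ∪ {u,v}, `R ℓ` is {u,v} ∪ B, and `M ℓ` is {u,v}.
  L R M : Fin m → Subset N
  L ℓ = segment (w ℓ) 0 (2 + a) (m≤n+m (2 + a) a)
  R ℓ = segment (w ℓ) a (2 + a) ≤-refl
  M ℓ = segment (w ℓ) a 2 (+-monoʳ-≤ a (m≤m+n 2 a))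

  L⁺ : ∀ ℓ t → toℕ t < 2 + a → w ℓ t ∈ L ℓ
  L⁺ ℓ t = ∈-segment⁺ (w ℓ) 0 (2 + a) (m≤n+m (2 + a) a) t z≤n

  R⁺ : ∀ ℓ t → a ≤ toℕ t → w ℓ t ∈ R ℓ
  R⁺ ℓ t a≤t = ∈-segment⁺ (w ℓ) a (2 + a) ≤-refl t a≤t (toℕ<n t)

  M⁺ : ∀ ℓ t → a ≤ toℕ t → toℕ t < 2 + a → w ℓ t ∈ M ℓ
  M⁺ ℓ t a≤t t<2+a = ∈-segment⁺ (w ℓ) a 2 (+-monoʳ-≤ a (m≤m+n 2 a)) t a≤t (subst (toℕ t <_) (+-comm 2 a) t<2+a)

  L⁻ : ∀ ℓ {v} → v ∈ L ℓ → ∃ λ t → w ℓ t ≡ v × toℕ t < 2 + a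
  L⁻ ℓ v∈ with ∈-segment⁻ (w ℓ) 0 (2 + a) (m≤n+m (2 + a) a) v∈
  ... | t , eq , _ , t<2+a = t , eq , t<2+a

  R⁻ : ∀ ℓ {v} → v ∈ R ℓ → ∃ λ t → w ℓ t ≡ v × a ≤ toℕ t
  R⁻ ℓ v∈ with ∈-segment⁻ (w ℓ) a (2 + a) ≤-refl v∈
  ... | t , eq , a≤t , _ = t , eq , a≤t

  M⁻ : ∀ ℓ {v} → v ∈ M ℓ → ∃ λ t → w ℓ t ≡ v × a ≤ toℕ t × toℕ t < 2 + a
  M⁻ ℓ v∈ with ∈-segment⁻ (w ℓ) a 2 (+-monoʳ-≤ a (m≤m+n 2 a)) v∈
  ... | t , eq , a≤t , t<a+2 = t , eq , a≤t , subst (toℕ t <_) (+-comm a 2) t<a+2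

  L-index : ∀ ℓ {t} → w ℓ t ∈ L ℓ → toℕ t < 2 + a
  L-index ℓ v∈ with L⁻ ℓ v∈
  ... | s , eq , s<2+a = subst (λ t → toℕ t < 2 + a) (w-inj ℓ eq) s<2+a

  R-index : ∀ ℓ {t} → w ℓ t ∈ R ℓ → a ≤ toℕ t
  R-index ℓ v∈ with R⁻ ℓ v∈
  ... | s , eq , a≤s = subst (λ t → a ≤ toℕ t) (w-inj ℓ eq) a≤s

  M⊆L : ∀ ℓ {v} → v ∈ M ℓ → v ∈ L ℓ
  M⊆L ℓ v∈ with M⁻ ℓ v∈
  ... | t , refl , _ , t<2+a = L⁺ ℓ t t<2+a

  M⊆R : ∀ ℓ {v} → v ∈ M ℓ → v ∈ R ℓ
  M⊆R ℓ v∈ with M⁻ ℓ v∈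
  ... | t , refl , a≤t , _ = R⁺ ℓ t a≤t

  L∩R≡M : ∀ ℓ → L ℓ ∩ R ℓ ≡ M ℓ
  L∩R≡M ℓ = ⊆-antisym to (λ v∈M → x∈p∩q⁺ (M⊆L ℓ v∈M , M⊆R ℓ v∈M))
    where
    to : ∀ {v} → v ∈ L ℓ ∩ R ℓ → v ∈ M ℓ
    to v∈ with x∈p∩q⁻ (L ℓ) (R ℓ) v∈
    ... | v∈L , v∈R with L⁻ ℓ v∈L
    ...   | t , refl , t<2+a = M⁺ ℓ t (R-index ℓ v∈R) t<2+a

  ∣M∣≡2 : ∀ ℓ → ∣ M ℓ ∣ ≡ 2
  ∣M∣≡2 ℓ = ∣segment∣ (w ℓ) a 2 (+-monoʳ-≤ a (m≤m+n 2 a)) (w-inj ℓ)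

  ∣L∩R∣≡2 : ∀ ℓ → ∣ L ℓ ∩ R ℓ ∣ ≡ 2
  ∣L∩R∣≡2 ℓ = trans (cong ∣_∣ (L∩R≡M ℓ)) (∣M∣≡2 ℓ)

  side : Fin m → Fin 2 → Subset N
  side ℓ 0F = L ℓ
  side ℓ 1F = R ℓ

  ∣side∣ : ∀ ℓ s → ∣ side ℓ s ∣ ≡ 2 + a
  ∣side∣ ℓ 0F = ∣segment∣ (w ℓ) 0 (2 + a) (m≤n+m (2 + a) a) (w-inj ℓ)
  ∣side∣ ℓ 1F = ∣segment∣ (w ℓ) a (2 + a) ≤-refl (w-inj ℓ)

  side-on-line : ∀ ℓ s {v} → v ∈ side ℓ s → ∃ λ t → w ℓ t ≡ v
  side-on-line ℓ 0F v∈ with L⁻ ℓ v∈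
  ... | t , eq , _ = t , eq
  side-on-line ℓ 1F v∈ with R⁻ ℓ v∈
  ... | t , eq , _ = t , eq

  ∣twins∩∣≡2 : ∀ ℓ {s s′} → s ≢ s′ → ∣ side ℓ s ∩ side ℓ s′ ∣ ≡ 2
  ∣twins∩∣≡2 ℓ {0F} {0F} s≢s′ = ⊥-elim (s≢s′ refl)
  ∣twins∩∣≡2 ℓ {0F} {1F} _    = ∣L∩R∣≡2 ℓ
  ∣twins∩∣≡2 ℓ {1F} {0F} _    = trans (cong ∣_∣ (∩-comm (R ℓ) (L ℓ))) (∣L∩R∣≡2 ℓ)
  ∣twins∩∣≡2 ℓ {1F} {1F} s≢s′ = ⊥-elim (s≢s′ refl)

  ∣strangers∩∣≤1 : ∀ {ℓ ℓ′} → ℓ ≢ ℓ′ → ∀ s s′ → ∣ side ℓ s ∩ side ℓ′ s′ ∣ ≤ 1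
  ∣strangers∩∣≤1 {ℓ} {ℓ′} ℓ≢ℓ′ s s′ = subsingleton⇒∣p∣≤1 _ unique
    where
    unique : ∀ {x y} → x ∈ side ℓ s ∩ side ℓ′ s′ → y ∈ side ℓ s ∩ side ℓ′ s′ → x ≡ y
    unique x∈ y∈ with x∈p∩q⁻ (side ℓ s) _ x∈ | x∈p∩q⁻ (side ℓ s) _ y∈
    ... | x∈₁ , x∈₂ | y∈₁ , y∈₂
      with side-on-line ℓ s x∈₁ | side-on-line ℓ′ s′ x∈₂ | side-on-line ℓ s y∈₁ | side-on-line ℓ′ s′ y∈₂
    ... | _ , refl | _ , eqx | _ , refl | _ , eqy = w-linear ℓ≢ℓ′ (sym eqx) (sym eqy)

  edges : Fin (m * 2) → Subset N
  edges i = uncurry side (remQuot 2 i)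

  edges-combine : ∀ ℓ s → edges (combine ℓ s) ≡ side ℓ s
  edges-combine ℓ s = cong (uncurry side) (remQuot-combine ℓ s)

  -- Edges of different gadgets share at most one vertex by `w-linear`. Hence an intersection of
  -- size two, as in the hypothesis of `Admits`, identifies the two sides of one gadget.
  twin-or-stranger : ∀ i j → i ≢ j →
    (∃ λ ℓ → ∃ λ s → ∃ λ s′ → s ≢ s′ × edges i ≡ side ℓ s × edges j ≡ side ℓ s′) ⊎ ∣ edges i ∩ edges j ∣ ≤ 1
  twin-or-stranger i j i≢j with combine-surjective {m} i | combine-surjective {m} j
  ... | ℓ , s , refl | ℓ′ , s′ , refl with ℓ ≟ᶠ ℓ′
  ...   | yes refl = inj₁ (ℓ , s , s′ , (λ s≡s′ → i≢j (cong (combine ℓ) s≡s′)) , edges-combine ℓ s , edges-combine ℓ s′)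
  ...   | no ℓ≢ℓ′  = inj₂ (subst₂ (λ e f → ∣ e ∩ f ∣ ≤ 1) (sym (edges-combine ℓ s)) (sym (edges-combine ℓ′ s′))
                             (∣strangers∩∣≤1 ℓ≢ℓ′ s s′))

  ∣edges∣ : ∀ i → ∣ edges i ∣ ≡ 2 + a
  ∣edges∣ i = uncurry ∣side∣ (remQuot 2 i)

  ∣edges∩∣≤2 : ∀ i j → i ≢ j → ∣ edges i ∩ edges j ∣ ≤ 2
  ∣edges∩∣≤2 i j i≢j with twin-or-stranger i j i≢j
  ... | inj₁ (ℓ , s , s′ , s≢s′ , eqi , eqj) =
    ≤-reflexive (trans (cong₂ (λ e f → ∣ e ∩ f ∣) eqi eqj) (∣twins∩∣≡2 ℓ s≢s′))
  ... | inj₂ ≤1 = m≤n⇒m≤1+n ≤1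

  -- Different indices give edges meeting in at most two vertices, whereas equal edges would share
  -- all `2 + a ≥ 3`.
  edges-injective : Injective _≡_ _≡_ edges
  edges-injective {i} {j} eq with i ≟ᶠ j
  ... | yes i≡j = i≡j
  ... | no  i≢j = ⊥-elim (<-irrefl refl (begin-strict
    2                       <⟨ s≤s (s≤s 1≤a) ⟩
    2 + a                   ≡⟨ sym (∣edges∣ i) ⟩
    ∣ edges i ∣             ≡⟨ cong ∣_∣ (sym (∩-idem (edges i))) ⟩
    ∣ edges i ∩ edges i ∣   ≡⟨ cong (λ e → ∣ edges i ∩ e ∣) eq ⟩
    ∣ edges i ∩ edges j ∣   ≤⟨ ∣edges∩∣≤2 i j i≢j ⟩
    2                       ∎))
    where open ≤-Reasoning

  graph : UGraph (2 + a)
  graph = record { n = N ; m = m * 2 ; edge = edges ; uniform = ∣edges∣ ; distinct = edges-injective }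

  opposite-≢ : ∀ (s : Fin 2) → s ≢ opposite s
  opposite-≢ 0F ()
  opposite-≢ 1F ()

  two-sides : ∀ (s s′ : Fin 2) → s ≢ s′ → s′ ≡ opposite s
  two-sides 0F 0F s≢s′ = ⊥-elim (s≢s′ refl)
  two-sides 0F 1F _    = refl
  two-sides 1F 0F _    = refl
  two-sides 1F 1F s≢s′ = ⊥-elim (s≢s′ refl)

  quasiLinear : QuasiLinear graph
  quasiLinear i with combine-surjective {m} i
  ... | ℓ , s , refl = combine ℓ (opposite s) ,
    (λ eq → opposite-≢ s (proj₂ (combine-injective ℓ s ℓ (opposite s) eq))) ,
    trans (cong₂ (λ e f → ∣ e ∩ f ∣) (edges-combine ℓ s) (edges-combine ℓ (opposite s))) (∣twins∩∣≡2 ℓ (opposite-≢ s)) ,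
    others
    where
    others : ∀ k → k ≢ combine ℓ s → k ≢ combine ℓ (opposite s) → ∣ edges (combine ℓ s) ∩ edges k ∣ ≤ 1
    others k k≢i k≢j with combine-surjective {m} k
    ... | ℓ′ , s′ , refl with ℓ ≟ᶠ ℓ′
    ...   | no ℓ≢ℓ′  = subst₂ (λ e f → ∣ e ∩ f ∣ ≤ 1) (sym (edges-combine ℓ s)) (sym (edges-combine ℓ′ s′))
                         (∣strangers∩∣≤1 ℓ≢ℓ′ s s′)
    ...   | yes refl with s ≟ᶠ s′
    ...     | yes refl = ⊥-elim (k≢i refl)
    ...     | no s≢s′  = ⊥-elim (k≢j (cong (combine ℓ) (two-sides s s′ s≢s′)))

  -- Under the identity order the increasing map `w ℓ` is itself the sorted list of `L ℓ ∪ R ℓ`.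
  L-R-described : ∀ ℓ → Describes (seqXZZY (2 + a)) idₚ (L ℓ) (R ℓ)
  L-R-described ℓ = w ℓ , w-inc ℓ , (λ v → covered v , λ { i refl → on-line i }) , inj₁ labels
    where
    covered : ∀ v → v ∈ (L ℓ ∪ R ℓ) → ∃ λ i → w ℓ i ≡ v
    covered v v∈ = Sum.[ side-on-line ℓ 0F , side-on-line ℓ 1F ]′ (x∈p∪q⁻ (L ℓ) (R ℓ) v∈)
    on-line : ∀ i → w ℓ i ∈ (L ℓ ∪ R ℓ)
    on-line i with toℕ i <? 2 + a
    ... | yes i<2+a = x∈p∪q⁺ (inj₁ (L⁺ ℓ i i<2+a))
    ... | no  i≮2+a = x∈p∪q⁺ (inj₂ (R⁺ ℓ i (m+n≤o⇒n≤o 2 (≮⇒≥ i≮2+a))))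
    labels : Labels (seqXZZY (2 + a)) (w ℓ) (L ℓ) (R ℓ)
    labels i with lookupᵛ (seqXZZY (2 + a)) i | letter-position a a i
    ... | _ | before i<a =
      ((λ _ → l , r) , λ _ → refl) , ((λ ()) , λ (x , _) → ⊥-elim (r x)) , ((λ ()) , λ (_ , x) → ⊥-elim (r x))
      where
      l : w ℓ i ∈ L ℓ
      l = L⁺ ℓ i (m≤n⇒m≤o+n 2 i<a)
      r : w ℓ i ∉ R ℓ
      r x = <⇒≱ i<a (R-index ℓ x)
    ... | _ | middle a≤i i<2+a =
      ((λ ()) , λ (_ , x) → ⊥-elim (x r)) , ((λ ()) , λ (_ , x) → ⊥-elim (x l)) , ((λ _ → l , r) , λ _ → refl)
      where
      l : w ℓ i ∈ L ℓ
      l = L⁺ ℓ i i<2+a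
      r : w ℓ i ∈ R ℓ
      r = R⁺ ℓ i a≤i
    ... | _ | after 2+a≤i =
      ((λ ()) , λ (x , _) → ⊥-elim (l x)) , ((λ _ → r , l) , λ _ → refl) , ((λ ()) , λ (x , _) → ⊥-elim (l x))
      where
      l : w ℓ i ∉ L ℓ
      l x = <⇒≱ (L-index ℓ x) 2+a≤i
      r : w ℓ i ∈ R ℓ
      r = R⁺ ℓ i (m+n≤o⇒n≤o 2 2+a≤i)

  twins-described : ∀ ℓ {s s′} → s ≢ s′ → Describes (seqXZZY (2 + a)) idₚ (side ℓ s) (side ℓ s′)
  twins-described ℓ {0F} {0F} s≢s′ = ⊥-elim (s≢s′ refl)
  twins-described ℓ {0F} {1F} _    = L-R-described ℓ
  twins-described ℓ {1F} {0F} _    = Describes-sym {σ = seqXZZY (2 + a)} {idₚ} {L ℓ} {R ℓ} (L-R-described ℓ)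
  twins-described ℓ {1F} {1F} s≢s′ = ⊥-elim (s≢s′ refl)

  admits : Admits graph (seqXZZY (2 + a))
  admits = idₚ , described
    where
    described : ∀ i j → i ≢ j → ∣ edges i ∩ edges j ∣ ≡ 2 → Describes (seqXZZY (2 + a)) idₚ (edges i) (edges j)
    described i j i≢j ≡2 with twin-or-stranger i j i≢j
    ... | inj₁ (ℓ , s , s′ , s≢s′ , eqi , eqj) =
      subst₂ (Describes (seqXZZY (2 + a)) idₚ) (sym eqi) (sym eqj) (twins-described ℓ s≢s′)
    ... | inj₂ ≤1 = ⊥-elim (<-irrefl refl (subst (_≤ 1) ≡2 ≤1))

  -- A gadget that π lists in increasing order has M as head of R and tail of L; reversing swaps the two sides.
  headTailMixing : (∀ (π : Order N) → ∃ λ ℓ → Monotone (λ t → toℕ (π ⟨$⟩ʳ w ℓ t))) → HeadTailMixing graph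
  headTailMixing monotone π with monotone π
  ... | ℓ , mono = mixed mono
    where
    -- Injectivity of `π` and of `w ℓ` upgrades weak monotonicity to the strict comparisons that
    -- heads and tails require.
    strict : ∀ {s t} → s <ᶠ t → toℕ (π ⟨$⟩ʳ w ℓ s) ≢ toℕ (π ⟨$⟩ʳ w ℓ t)
    strict s<t eq = <-irrefl (cong toℕ (w-inj ℓ (Injection.injective (↔⇒↣ π) (toℕ-injective eq)))) s<t

    L∖M-index : ∀ {t} → w ℓ t ∈ L ℓ → w ℓ t ∉ M ℓ → toℕ t < a
    L∖M-index {t} v∈L v∉M = ≰⇒> λ a≤t → v∉M (M⁺ ℓ t a≤t (L-index ℓ v∈L))

    R∖M-index : ∀ {t} → w ℓ t ∈ R ℓ → w ℓ t ∉ M ℓ → 2 + a ≤ toℕ t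
    R∖M-index {t} v∈R v∉M = ≮⇒≥ λ t<2+a → v∉M (M⁺ ℓ t (R-index ℓ v∈R) t<2+a)

    L<M : ∀ u v → u ∈ M ℓ → v ∈ L ℓ → v ∉ M ℓ → ∃ λ s → ∃ λ t → w ℓ s ≡ v × w ℓ t ≡ u × s <ᶠ t
    L<M u v u∈ v∈ v∉ with M⁻ ℓ u∈ | side-on-line ℓ 0F v∈
    ... | t , refl , a≤t , _ | s , refl = s , t , refl , refl , <-≤-trans (L∖M-index v∈ v∉) a≤t

    M<R : ∀ u v → u ∈ M ℓ → v ∈ R ℓ → v ∉ M ℓ → ∃ λ s → ∃ λ t → w ℓ s ≡ u × w ℓ t ≡ v × s <ᶠ t
    M<R u v u∈ v∈ v∉ with M⁻ ℓ u∈ | side-on-line ℓ 1F v∈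
    ... | s , refl , _ , s<2+a | t , refl = s , t , refl , refl , <-≤-trans s<2+a (R∖M-index v∈ v∉)

    mixed : Monotone (λ t → toℕ (π ⟨$⟩ʳ w ℓ t)) → ∃ λ i → ∃ λ j → ∃ λ T → IsHead π (edges i) T × IsTail π (edges j) T
    mixed (inj₁ up) = combine ℓ 1F , combine ℓ 0F , M ℓ ,
      subst (λ e → IsHead π e (M ℓ)) (sym (edges-combine ℓ 1F)) ((λ v → M⊆R ℓ) , ∣M∣≡2 ℓ , head) ,
      subst (λ e → IsTail π e (M ℓ)) (sym (edges-combine ℓ 0F)) ((λ v → M⊆L ℓ) , ∣M∣≡2 ℓ , tail)
      where
      head : ∀ u v → u ∈ M ℓ → v ∈ R ℓ → v ∉ M ℓ → u ≺[ π ] v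
      head u v u∈ v∈ v∉ with M<R u v u∈ v∈ v∉
      ... | s , t , refl , refl , s<t = ≤∧≢⇒< (up s t s<t) (strict s<t)
      tail : ∀ u v → u ∈ M ℓ → v ∈ L ℓ → v ∉ M ℓ → v ≺[ π ] u
      tail u v u∈ v∈ v∉ with L<M u v u∈ v∈ v∉
      ... | s , t , refl , refl , s<t = ≤∧≢⇒< (up s t s<t) (strict s<t)
    mixed (inj₂ down) = combine ℓ 0F , combine ℓ 1F , M ℓ ,
      subst (λ e → IsHead π e (M ℓ)) (sym (edges-combine ℓ 0F)) ((λ v → M⊆L ℓ) , ∣M∣≡2 ℓ , head) ,
      subst (λ e → IsTail π e (M ℓ)) (sym (edges-combine ℓ 1F)) ((λ v → M⊆R ℓ) , ∣M∣≡2 ℓ , tail)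
      where
      head : ∀ u v → u ∈ M ℓ → v ∈ L ℓ → v ∉ M ℓ → u ≺[ π ] v
      head u v u∈ v∈ v∉ with L<M u v u∈ v∈ v∉
      ... | s , t , refl , refl , s<t = ≤∧≢⇒< (down s t s<t) (strict s<t ∘ sym)
      tail : ∀ u v → u ∈ M ℓ → v ∈ R ℓ → v ∉ M ℓ → v ≺[ π ] u
      tail u v u∈ v∈ v∉ with M<R u v u∈ v∈ v∉
      ... | s , t , refl , refl , s<t = ≤∧≢⇒< (down s t s<t) (strict s<t ∘ sym)

-- Lines in a grid.

-- With `j = suc i + d`, subtracting the equations gives `suc d * b ≡ suc d * b′`; equal slopes then
-- force equal intercepts.
two-points-determine-line : ∀ {a b a′ b′ i j} → i < j →
  a + i * b ≡ a′ + i * b′ → a + j * b ≡ a′ + j * b′ → a ≡ a′ × b ≡ b′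
two-points-determine-line {a} {b} {a′} {b′} {i} i<j eqᵢ eqⱼ with m≤n⇒∃[o]m+o≡n i<j
... | d , refl = +-cancelʳ-≡ (i * b) a a′ (trans eqᵢ (cong (λ x → a′ + i * x) (sym b≡b′))) , b≡b′
  where
  shift : ∀ a b i d → a + (suc i + d) * b ≡ (a + i * b) + suc d * b
  shift = solve-∀
  b≡b′ : b ≡ b′
  b≡b′ = *-cancelˡ-≡ b b′ (suc d) (+-cancelˡ-≡ (a + i * b) _ _ (begin
    a + i * b + suc d * b      ≡⟨ sym (shift a b i d) ⟩
    a + (suc i + d) * b        ≡⟨ eqⱼ ⟩
    a′ + (suc i + d) * b′      ≡⟨ shift a′ b′ i d ⟩
    a′ + i * b′ + suc d * b′   ≡⟨ cong (_+ suc d * b′) (sym eqᵢ) ⟩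
    a + i * b + suc d * b′     ∎))
    where open ≡-Reasoning

module Lines (K q : ℕ) where

  -- Ordinates are natural numbers, not residues modulo `q`: an intercept below `q` plus at most
  -- `K * q`.
  height : ℕ
  height = suc K * q

  ordinate< : ∀ (a b : Fin q) (i : Fin K) → toℕ a + toℕ i * toℕ b < height
  ordinate< a b i = +-mono-<-≤ (toℕ<n a) (*-mono-≤ (<⇒≤ (toℕ<n i)) (<⇒≤ (toℕ<n b)))

  -- The index `ℓ` encodes intercept and slope. The column is the leading digit of the point, so
  -- each line is increasing in the natural order of the vertices.
  point : Fin (q * q) → Fin K → Fin (K * height)
  point ℓ i = let a , b = remQuot q ℓ in combine i (fromℕ< (ordinate< a b i))

  point-column : ∀ {ℓ ℓ′ i i′} → point ℓ i ≡ point ℓ′ i′ → i ≡ i′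
  point-column eq = combine-injectiveˡ _ _ _ _ eq

  point-ordinate : ∀ {ℓ ℓ′ i i′} → point ℓ i ≡ point ℓ′ i′ →
    let a , b = remQuot q ℓ ; a′ , b′ = remQuot q ℓ′ in toℕ a + toℕ i * toℕ b ≡ toℕ a′ + toℕ i * toℕ b′
  point-ordinate {ℓ} {ℓ′} {i} eq with point-column {ℓ} {ℓ′} eq
  ... | refl = trans (sym (toℕ-fromℕ< (ordinate< _ _ i)))
                     (trans (cong toℕ (combine-injectiveʳ i _ i _ eq)) (toℕ-fromℕ< (ordinate< _ _ i)))

  point-mono : ∀ ℓ → Increasing (point ℓ)
  point-mono ℓ i j i<j = combine-monoˡ-< _ _ i<j

  <⇒same-line : ∀ {ℓ ℓ′ i j i′ j′} → i <ᶠ j → point ℓ i ≡ point ℓ′ i′ → point ℓ j ≡ point ℓ′ j′ → ℓ ≡ ℓ′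
  <⇒same-line {ℓ} {ℓ′} i<j eqᵢ eqⱼ
    with two-points-determine-line i<j (point-ordinate {ℓ} {ℓ′} eqᵢ) (point-ordinate {ℓ} {ℓ′} eqⱼ)
  ... | a≡a′ , b≡b′ = trans (sym (combine-remQuot {q} q ℓ))
    (trans (cong₂ combine (toℕ-injective a≡a′) (toℕ-injective b≡b′)) (combine-remQuot {q} q ℓ′))

  lines-linear : ∀ {ℓ ℓ′} → ℓ ≢ ℓ′ → ∀ {i j i′ j′} → point ℓ i ≡ point ℓ′ i′ → point ℓ j ≡ point ℓ′ j′ → i ≡ j
  lines-linear {ℓ} {ℓ′} ℓ≢ℓ′ {i} {j} eqᵢ eqⱼ with <ᶠ-cmp i j
  ... | tri< i<j _ _ = ⊥-elim (ℓ≢ℓ′ (<⇒same-line {ℓ} {ℓ′} i<j eqᵢ eqⱼ))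
  ... | tri≈ _ i≡j _ = i≡j
  ... | tri> _ _ j<i = ⊥-elim (ℓ≢ℓ′ (<⇒same-line {ℓ} {ℓ′} j<i eqⱼ eqᵢ))

-- Numbering the possible gadgets on a line.

module IncreasingMaps {k K : ℕ} (default : Fin k → Fin K) (default-inc : Increasing default) where

  -- `greedy` takes a number of choices of the form `suc c`, hence one code besides those of the
  -- `K ^ k` maps. Codes of maps that are not increasing fall back to `default`, so every code
  -- yields a valid gadget.
  decode : Fin (suc (K ^ k)) → Fin k → Fin K
  decode zero    = default
  decode (suc c) with increasing? (finToFun {K} {k} c)
  ... | yes _ = finToFun {K} {k} c
  ... | no  _ = default

  decode-inc : ∀ c → Increasing (decode c)
  decode-inc zero    = default-inc
  decode-inc (suc c) with increasing? (finToFun {K} {k} c)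
  ... | yes inc = inc
  ... | no  _   = default-inc

  decode-surjective : ∀ w → Increasing w → ∃ λ c → decode c ≗ w
  decode-surjective w w-inc = suc (funToFin w) , eq
    where
    eq : decode (suc (funToFin w)) ≗ w
    eq t with increasing? (finToFun {K} {k} (funToFin w))
    ... | yes _   = finToFun-funToFin w t
    ... | no ¬inc = ⊥-elim (¬inc λ s t s<t →
      subst₂ _<ᶠ_ (sym (finToFun-funToFin w s)) (sym (finToFun-funToFin w t)) (w-inc s t s<t))

-- Choosing the gadgets and assembling the hypergraph.

gadgetSize : ℕ → ℕ
gadgetSize a = a + (2 + a)

module Construction (a K q : ℕ)
  (subsequence : ∀ (x : Fin K → ℕ) → ∃ λ (w : Fin (gadgetSize (suc a)) → Fin K) → Increasing w × Monotone (x ∘ w))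
  (enough-lines : (K * suc K * q) ^ (K * suc K * q) * (K ^ gadgetSize (suc a)) ^ (q * q)
                  < suc (K ^ gadgetSize (suc a)) ^ (q * q))
  where

  k : ℕ
  k = gadgetSize (suc a)

  default : ∃ λ (w : Fin k → Fin K) → Increasing w × Monotone {k} (λ _ → 0)
  -- Applying `subsequence` to a constant function supplies some increasing map.
  default = subsequence (λ _ → 0)

  open IncreasingMaps (proj₁ default) (proj₁ (proj₂ default))

  open Lines K q

  N : ℕ
  N = K * height

  -- The number `x` codes an arbitrary self-map of the `N` vertices; the permutations that represent
  -- orders are among these.
  MonotoneOn : Fin (q * q) → Fin (suc (K ^ k)) → Fin (N ^ N) → Set
  MonotoneOn ℓ c x = Monotone (λ t → toℕ (finToFun {N} {N} x (point ℓ (decode c t))))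

  monotoneOn : ∀ ℓ x → ∃ λ c → MonotoneOn ℓ c x
  monotoneOn ℓ x with subsequence (λ i → toℕ (finToFun {N} {N} x (point ℓ i)))
  ... | w , w-inc , mono with decode-surjective w w-inc
  ...   | c , eq = c , Monotone-cong (λ t → cong (λ i → toℕ (finToFun {N} {N} x (point ℓ i))) (sym (eq t))) mono

  few : length (allFin (N ^ N)) * (K ^ k) ^ (q * q) < suc (K ^ k) ^ (q * q)
  few = subst (λ x → x * (K ^ k) ^ (q * q) < suc (K ^ k) ^ (q * q))
    (trans (cong (λ x → x ^ x) (*-assoc K (suc K) q)) (sym (length-tabulate id))) enough-lines

  choice : ∃ λ (f : Fin (q * q) → Fin (suc (K ^ k))) → ∀ {x} → x ∈ˡ allFin (N ^ N) → ∃ λ ℓ → MonotoneOn ℓ (f ℓ) x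
  choice = greedy (q * q) (K ^ k) (λ ℓ c x → monotone? _) monotoneOn (allFin (N ^ N)) few

  gadget : Fin (q * q) → Fin k → Fin N
  gadget ℓ t = point ℓ (decode (proj₁ choice ℓ) t)

  gadget-inc : ∀ ℓ → Increasing (gadget ℓ)
  gadget-inc ℓ s t s<t = point-mono ℓ _ _ (decode-inc (proj₁ choice ℓ) s t s<t)

  gadget-linear : ∀ {ℓ ℓ′} → ℓ ≢ ℓ′ → ∀ {s t s′ t′} →
    gadget ℓ s ≡ gadget ℓ′ s′ → gadget ℓ t ≡ gadget ℓ′ t′ → gadget ℓ s ≡ gadget ℓ t
  gadget-linear {ℓ} {ℓ′} ℓ≢ℓ′ eqₛ eqₜ = cong (point ℓ) (lines-linear {ℓ} {ℓ′} ℓ≢ℓ′ eqₛ eqₜ)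

  open Gadgets (suc a) (s≤s z≤n) gadget gadget-inc (λ {ℓ} {ℓ′} → gadget-linear {ℓ} {ℓ′}) public using (graph; quasiLinear; headTailMixing; admits)

  monotone-gadget : ∀ (π : Order N) → ∃ λ ℓ → Monotone (λ t → toℕ (π ⟨$⟩ʳ gadget ℓ t))
  monotone-gadget π = map₂ (λ {ℓ} → Monotone-cong (decoded ℓ)) found
    where
    x : Fin (N ^ N)
    x = funToFin {N} {N} (π ⟨$⟩ʳ_)
    found : ∃ λ ℓ → MonotoneOn ℓ (proj₁ choice ℓ) x
    found = proj₂ choice (∈-allFin x)
    decoded : ∀ ℓ t → toℕ (finToFun {N} {N} x (gadget ℓ t)) ≡ toℕ (π ⟨$⟩ʳ gadget ℓ t)
    decoded ℓ t = cong toℕ (finToFun-funToFin {N} {N} (π ⟨$⟩ʳ_) (gadget ℓ t))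

theorem3p3 : (r : ℕ) → 3 ≤ r →
    Σ (UGraph r) λ F → QuasiLinear F × HeadTailMixing F × Admits F (seqXZZY r)
theorem3p3 (suc (suc (suc a))) (s≤s (s≤s (s≤s z≤n))) =
  graph , quasiLinear , headTailMixing monotone-gadget , admits
  where
  k K : ℕ
  -- Here `r = 3 + a`, so `k` is `2 r - 2`, the size of the union of a twin pair.
  k = gadgetSize (suc a)
  K = ramseyNumber k k
  enough-lines : ∃ λ q → (K * suc K * q) ^ (K * suc K * q) * (K ^ k) ^ (q * q) < suc (K ^ k) ^ (q * q)
  -- Each line offers `suc (K ^ k)` choices, and the grid has `K * suc K * q` points.
  enough-lines = few-orders (K ^ k) (K * suc K) {{m^n≢0 K k}}
  open Construction a K (proj₁ enough-lines) (monotone-subsequence k) (proj₂ enough-lines)
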